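{- Let $N$ and $i$ be positive integers such that $N$ is a multiple of both $i$ and $i+1$, and let $q$ be an integer with $N/(i+1)<q\le N/i$ (necessarily $q\ge 2$). Then the map $$F_i\to F_N^{1/q,\,1/(q-1)},\qquad \frac{h}{k}\mapsto \frac{k}{kq-h}$$ (with $h/k$ in lowest terms) is a well-defined, order-preserving bijection.
   Context: For a positive integer $N$, the Farey sequence of order $N$, $F_N$, is the increasing list of all reduced fractions $h/k$ with $0\le h\le k\le N$ and $\gcd(h,k)=1$; it begins with $0/1$ and ends with $1/1$. For integers $1\le b\le a\le N$, $F_N^{1/a,\,1/b}$ denotes the subsequence of $F_N$ consisting of all its fractions lying in the closed interval $[1/a,\,1/b]$. -}

module Defs where

open import Data.Integer as ℤ using (ℤ; +_; -[1+_]; +≤+)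
open import Data.List.Base using (List; concatMap; filter; mapMaybe; upTo)
open import Data.List.Membership.Propositional using (_∈_)
open import Data.List.Sort using (sort)
open import Data.Maybe.Base using (Maybe; just; nothing)
open import Data.Nat.Base as ℕ using (ℕ; suc; s≤s)
open import Data.Nat.Coprimality using (coprime?)
open import Data.Product.Base using (∃; proj₁)
open import Data.Rational as ℚ using (ℚ; mkℚ; _/_)
open import Data.Rational.Properties using (≤-decTotalOrder)
open import Relation.Binary.PropositionalEquality using (_≡_)
open import Relation.Nullary.Decidable using (yes; no; _×-dec_)

infixl 7 _÷_

_÷_ : (m n : ℤ) .{{_ : ℤ.NonZero n}} → ℚ
m ÷ (+ n)    = m / n
m ÷ -[1+ n ] = (ℤ.- m) / suc n

-- As in mkℚ, the second argument is the denominator minus one.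
reduced : ℕ → ℕ → Maybe ℚ
reduced h k-1 with coprime? h (suc k-1)
... | yes c = just (mkℚ (+ h) k-1 c)
... | no  _ = nothing

-- Each value is enumerated at most once, since only coprime pairs h, k
-- contribute, so sorting yields a strictly increasing list.
farey : ℕ → List ℚ
farey N = sort ≤-decTotalOrder
  (concatMap (λ k-1 → mapMaybe (λ h → reduced h k-1) (upTo (suc (suc k-1)))) (upTo N))

-- The fractions of farey N in the closed interval [1/a, 1/b].
fareyBetween : ℕ → (a b : ℤ) .{{_ : ℤ.NonZero a}} .{{_ : ℤ.NonZero b}} → List ℚ
fareyBetween N a b =
  filter (λ x → (+ 1 ÷ a ℚ.≤? x) ×-dec (x ℚ.≤? + 1 ÷ b)) (farey N)

Elem : List ℚ → Set
Elem xs = ∃ λ x → x ∈ xs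

-- Elements are compared by value only, ignoring the membership proof.
_≈_ : ∀ {xs ys} → Elem xs → Elem ys → Set
x ≈ y = proj₁ x ≡ proj₁ y

_≲_ : ∀ {xs ys} → Elem xs → Elem ys → Set
x ≲ y = proj₁ x ℚ.≤ proj₁ y

nonZero-q : ∀ {q} → + 2 ℤ.≤ q → ℤ.NonZero q
nonZero-q (+≤+ (s≤s _)) = _

nonZero-q-1 : ∀ {q} → + 2 ℤ.≤ q → ℤ.NonZero (q ℤ.- + 1)
nonZero-q-1 (+≤+ (s≤s (s≤s _))) = _

{-# OPTIONS --safe #-}

-- The image of h/k is k/d with d + h = k q. This relation determines h from (k, d),
-- preserves coprimality, turns 0 ≤ h ≤ k into k (q − 1) ≤ d ≤ k q, i.e. 1/q ≤ k/d ≤ 1/(q − 1),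
-- and gives d ≤ i q ≤ N. For surjectivity the remaining point is that k/d in the target has
-- k ≤ i; as i + 1 divides N, the lower bound on q gives N ≤ (i + 1)(q − 1), which forces
-- k (q − 1) = d = N if k > i, contradicting coprimality.
module Submission where

open import Defs
open import Data.Integer as ℤ using (ℤ; +_; -[1+_]; +≤+)
import Data.Integer.Properties as ℤₚ
open import Data.List.Base using (List; _∷_; mapMaybe; upTo)
open import Data.List.Membership.Propositional using (_∈_; find; lose)
open import Data.List.Membership.Propositional.Properties
  using (∈-concatMap⁺; ∈-concatMap⁻; ∈-filter⁺; ∈-filter⁻; ∈-upTo⁺; ∈-upTo⁻)
open import Data.List.Relation.Binary.Permutation.Propositional using (↭-sym)
open import Data.List.Relation.Binary.Permutation.Propositional.Properties using (∈-resp-↭)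
open import Data.List.Relation.Unary.Any using (here; there)
open import Data.List.Sort using (sort-↭)
open import Data.Maybe.Base using (Maybe; just; nothing)
open import Data.Nat as ℕ using (ℕ; suc; zero; s≤s; z≤n; _+_; _*_; _∸_; _≤_; _<_)
open import Data.Nat.Coprimality as Coprimality using (Coprime; coprime?; 1-coprimeTo)
open import Data.Nat.Divisibility using (_∣_; divides; ∣⇒≤; ∣-refl; ∣m+n∣m⇒∣n; ∣m⇒∣m*n; m∣m*n)
open import Data.Nat.Properties
open import Data.Nat.Tactic.RingSolver using (solve-∀)
open import Data.Product using (Σ-syntax; ∃; _×_; _,_; proj₁)
open import Data.Rational as ℚ using (ℚ; mkℚ; ↥_; ↧_; _/_; *≤*)
import Data.Rational.Properties as ℚₚ
import Data.Rational.Unnormalised as ℚᵘ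
import Data.Rational.Unnormalised.Properties as ℚᵘₚ
open import Function.Definitions using (Bijective)
open import Relation.Binary.Morphism.Structures using (IsOrderHomomorphism)
open import Relation.Binary.PropositionalEquality
  using (_≡_; refl; sym; trans; cong; subst; subst₂)
open import Relation.Nullary.Decidable using (yes; no; _×-dec_)
open import Relation.Nullary.Negation using (contradiction)

-- Membership in the Farey list.

module _ {a b} {A : Set a} {B : Set b} (f : A → Maybe B) where

  ∈-mapMaybe⁺ : ∀ {x y xs} → x ∈ xs → f x ≡ just y → y ∈ mapMaybe f xs
  ∈-mapMaybe⁺ (here refl) fx≡ rewrite fx≡ = here refl
  ∈-mapMaybe⁺ {xs = z ∷ _} (there x∈) fx≡ with f z
  ... | just _  = there (∈-mapMaybe⁺ x∈ fx≡)
  ... | nothing = ∈-mapMaybe⁺ x∈ fx≡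

  ∈-mapMaybe⁻ : ∀ {y} xs → y ∈ mapMaybe f xs → ∃ λ x → x ∈ xs × f x ≡ just y
  ∈-mapMaybe⁻ (z ∷ xs) y∈ with f z in fz≡ | y∈
  ... | just _  | here refl = z , here refl , fz≡
  ... | just _  | there y∈′ with x , x∈ , fx≡ ← ∈-mapMaybe⁻ xs y∈′ = x , there x∈ , fx≡
  ... | nothing | y∈′       with x , x∈ , fx≡ ← ∈-mapMaybe⁻ xs y∈′ = x , there x∈ , fx≡

-- Matching on `fraction` exposes the numerator as a natural number; coprimality stays irrelevant,
-- as in `mkℚ`.
data IsFarey (N : ℕ) : ℚ → Set where
  fraction : ∀ {h k-1} .{c : Coprime h (suc k-1)} →
             h ≤ suc k-1 → suc k-1 ≤ N → IsFarey N (mkℚ (+ h) k-1 c)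

reduced-coprime : ∀ {h k-1} .(c : Coprime h (suc k-1)) → reduced h k-1 ≡ just (mkℚ (+ h) k-1 c)
reduced-coprime {h} {k-1} c with coprime? h (suc k-1)
... | yes _ = refl
-- Coprimality is decidable, so a usable proof can be recovered from the irrelevant `c`.
... | no ¬c = contradiction (λ {d} → Coprimality.recompute c {d}) ¬c

reduced-just : ∀ {N} h k-1 {x} → h ≤ suc k-1 → suc k-1 ≤ N → reduced h k-1 ≡ just x → IsFarey N x
reduced-just h k-1 h≤k k≤N eq with coprime? h (suc k-1)
reduced-just h k-1 h≤k k≤N refl | yes _ = fraction h≤k k≤N

∈-farey⁺ : ∀ {N x} → IsFarey N x → x ∈ farey N
∈-farey⁺ {N} (fraction {h} {k-1} {c} h≤k k≤N) =
  ∈-resp-↭ (↭-sym (sort-↭ ℚₚ.≤-decTotalOrder _))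
    (∈-concatMap⁺ _ (lose (∈-upTo⁺ k≤N)
      (∈-mapMaybe⁺ (λ h → reduced h k-1) (∈-upTo⁺ (s≤s h≤k)) (reduced-coprime c))))

∈-farey⁻ : ∀ {N x} → x ∈ farey N → IsFarey N x
∈-farey⁻ {N} x∈
  with k-1 , k∈ , x∈ₖ ← find (∈-concatMap⁻ _ {xs = upTo N} (∈-resp-↭ (sort-↭ ℚₚ.≤-decTotalOrder _) x∈))
  with h , h∈ , eq ← ∈-mapMaybe⁻ (λ h → reduced h k-1) (upTo (suc (suc k-1))) x∈ₖ
  = reduced-just h k-1 (ℕ.s≤s⁻¹ (∈-upTo⁻ h∈)) (∈-upTo⁻ k∈) eq

-- Fraction inequalities as integer inequalities.

-- `_/_` reduces to lowest terms; passing to unnormalised rationals gives cross-multiplication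
-- without handling the gcd.
/-cancel-< : ∀ m n a b → m / suc a ℚ.< n / suc b → m ℤ.* + suc b ℤ.< n ℤ.* + suc a
/-cancel-< m n a b lt
  with ℚᵘ.*<* lt′ ← ℚᵘₚ.<-respˡ-≃ (ℚₚ.toℚᵘ-fromℚᵘ (ℚᵘ.mkℚᵘ m a))
                     (ℚᵘₚ.<-respʳ-≃ (ℚₚ.toℚᵘ-fromℚᵘ (ℚᵘ.mkℚᵘ n b)) (ℚₚ.toℚᵘ-mono-< lt)) = lt′

/-cancel-≤ : ∀ m n a b → m / suc a ℚ.≤ n / suc b → m ℤ.* + suc b ℤ.≤ n ℤ.* + suc a
/-cancel-≤ m n a b le
  with ℚᵘ.*≤* le′ ← ℚᵘₚ.≤-respˡ-≃ (ℚₚ.toℚᵘ-fromℚᵘ (ℚᵘ.mkℚᵘ m a))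
                     (ℚᵘₚ.≤-respʳ-≃ (ℚₚ.toℚᵘ-fromℚᵘ (ℚᵘ.mkℚᵘ n b)) (ℚₚ.toℚᵘ-mono-≤ le)) = le′

pos-*-cancel-≤ : ∀ a b c d → + a ℤ.* + b ℤ.≤ + c ℤ.* + d → a * b ≤ c * d
pos-*-cancel-≤ a b c d le =
  ℤₚ.drop‿+≤+ (subst₂ ℤ._≤_ (sym (ℤₚ.pos-* a b)) (sym (ℤₚ.pos-* c d)) le)

pos-*-mono-≤ : ∀ a b c d → a * b ≤ c * d → + a ℤ.* + b ℤ.≤ + c ℤ.* + d
pos-*-mono-≤ a b c d le =
  subst₂ ℤ._≤_ (ℤₚ.pos-* a b) (ℤₚ.pos-* c d) (+≤+ le)

-- As 1 is coprime to every n, `1 / n` is already in lowest terms; rewriting it to its `mkℚ` form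
-- lets the order unfold to cross-multiplication.
1/n≤⁺ : ∀ n-1 {k d-1} .{c : Coprime k (suc d-1)} →
        suc d-1 ≤ k * suc n-1 → + 1 / suc n-1 ℚ.≤ mkℚ (+ k) d-1 c
1/n≤⁺ n-1 {k} {d-1} {c} d≤kn
  rewrite ℚₚ.normalize-coprime {1} {n-1} (1-coprimeTo (suc n-1)) =
  *≤* (pos-*-mono-≤ 1 (suc d-1) k (suc n-1) (≤-trans (≤-reflexive (*-identityˡ _)) d≤kn))

1/n≤⁻ : ∀ n-1 {k d-1} .{c : Coprime k (suc d-1)} →
        + 1 / suc n-1 ℚ.≤ mkℚ (+ k) d-1 c → suc d-1 ≤ k * suc n-1
1/n≤⁻ n-1 {k} {d-1} {c} le
  rewrite ℚₚ.normalize-coprime {1} {n-1} (1-coprimeTo (suc n-1)) =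
  ≤-trans (≤-reflexive (sym (*-identityˡ _)))
          (pos-*-cancel-≤ 1 (suc d-1) k (suc n-1) (ℚₚ.drop-*≤* le))

≤1/n⁺ : ∀ n-1 {k d-1} .{c : Coprime k (suc d-1)} →
        k * suc n-1 ≤ suc d-1 → mkℚ (+ k) d-1 c ℚ.≤ + 1 / suc n-1
≤1/n⁺ n-1 {k} {d-1} {c} kn≤d
  rewrite ℚₚ.normalize-coprime {1} {n-1} (1-coprimeTo (suc n-1)) =
  *≤* (pos-*-mono-≤ k (suc n-1) 1 (suc d-1) (≤-trans kn≤d (≤-reflexive (sym (*-identityˡ _)))))

≤1/n⁻ : ∀ n-1 {k d-1} .{c : Coprime k (suc d-1)} →
        mkℚ (+ k) d-1 c ℚ.≤ + 1 / suc n-1 → k * suc n-1 ≤ suc d-1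
≤1/n⁻ n-1 {k} {d-1} {c} le
  rewrite ℚₚ.normalize-coprime {1} {n-1} (1-coprimeTo (suc n-1)) =
  ≤-trans (pos-*-cancel-≤ k (suc n-1) 1 (suc d-1) (ℚₚ.drop-*≤* le))
          (≤-reflexive (*-identityˡ _))

-- The fraction k/(kq - h).

÷-coprime : ∀ {k d-1} {m : ℤ} .{{nz : ℤ.NonZero m}} .(c : Coprime k (suc d-1)) →
            m ≡ + suc d-1 → mkℚ (+ k) d-1 c ≡ + k ÷ m
÷-coprime c refl = sym (ℚₚ.normalize-coprime c)

-- A common divisor of `k` and `d` divides `k * Q` and `d`, hence their difference `h`.
coprime-complement : ∀ {h k d} Q → d + h ≡ k * Q → Coprime h k → Coprime k d
coprime-complement {k = k} Q eq c {e} (e∣k , e∣d) =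
  c (∣m+n∣m⇒∣n (subst (e ∣_) (sym eq) (∣m⇒∣m*n Q e∣k)) e∣d , e∣k)

-- p is q − 2 throughout, so that q and q − 1 are visibly nonzero.
module _ (p : ℕ) where

  private
    Q = suc (suc p)

  -- suc (imageDen-1 h k-1) = k (q − 1) + (k − h), which is k q − h as long as h ≤ k.
  imageDen-1 : ℕ → ℕ → ℕ
  imageDen-1 h k-1 = p + k-1 * suc p + (suc k-1 ∸ h)

  imageDen-spec : ∀ {h k-1} → h ≤ suc k-1 → suc (imageDen-1 h k-1) + h ≡ suc k-1 * Q
  imageDen-spec {h} {k-1} h≤k = begin
    k * suc p + (k ∸ h) + h   ≡⟨ +-assoc (k * suc p) _ _ ⟩
    k * suc p + (k ∸ h + h)   ≡⟨ cong (_+_ (k * suc p)) (m∸n+n≡m h≤k) ⟩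
    k * suc p + k             ≡⟨ +-comm (k * suc p) k ⟩
    k + k * suc p             ≡⟨ *-suc k (suc p) ⟨
    k * Q                     ∎
    where
    open Relation.Binary.PropositionalEquality.≡-Reasoning
    k = suc k-1

  image : ∀ {i x} → IsFarey i x → ℚ
  image (fraction {h} {k-1} {c} h≤k _) =
    mkℚ (+ suc k-1) (imageDen-1 h k-1) (coprime-complement Q (imageDen-spec h≤k) c)

  imageDen-ℤ : ∀ {h k-1} → h ≤ suc k-1 →
               + suc k-1 ℤ.* + Q ℤ.- + h ≡ + suc (imageDen-1 h k-1)
  imageDen-ℤ {h} {k-1} h≤k = begin
    + k ℤ.* + Q ℤ.- + h   ≡⟨ cong (ℤ._- + h) (ℤₚ.pos-* k Q) ⟨
    + (k * Q) ℤ.- + h     ≡⟨ cong (λ z → + z ℤ.- + h) (imageDen-spec h≤k) ⟨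
    + (d + h) ℤ.- + h     ≡⟨ ℤₚ.m-n≡m⊖n (d + h) h ⟩
    (d + h) ℤ.⊖ h         ≡⟨ ℤₚ.⊖-≥ (m≤n+m h d) ⟩
    + (d + h ∸ h)         ≡⟨ cong +_ (m+n∸n≡m d h) ⟩
    + d                   ∎
    where
    open Relation.Binary.PropositionalEquality.≡-Reasoning
    k = suc k-1
    d = suc (imageDen-1 h k-1)

  image-formula : ∀ {i x} (f : IsFarey i x) →
    Σ[ nz ∈ ℤ.NonZero (↧ x ℤ.* + Q ℤ.- ↥ x) ]
      image f ≡ (↧ x ÷ (↧ x ℤ.* + Q ℤ.- ↥ x)) {{nz}}
  image-formula (fraction {h} {k-1} {c} h≤k _) = nz , ÷-coprime {{nz}} _ (imageDen-ℤ h≤k)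
    where
    nz : ℤ.NonZero (+ suc k-1 ℤ.* + Q ℤ.- + h)
    nz = subst ℤ.NonZero (sym (imageDen-ℤ h≤k)) _

  -- `image` is computed from a derivation of `IsFarey`; its value must not depend on which one,
  -- since elements are compared without their membership proofs.
  image-cong : ∀ {i x y} (f : IsFarey i x) (g : IsFarey i y) → x ≡ y → image f ≡ image g
  image-cong (fraction _ _) (fraction _ _) refl = refl

  -- Equal images share `k` and `d`, and then `d + h ≡ k * Q` determines `h` by cancellation.
  image-injective : ∀ {i x y} (f : IsFarey i x) (g : IsFarey i y) → image f ≡ image g → x ≡ y
  image-injective (fraction {h} h≤k _) (fraction {h′} h′≤k _) eq
    with refl , d≡d′ ← ℚₚ.mkℚ-injective eq =
    ℚₚ.mkℚ-cong (cong +_ (+-cancelˡ-≡ _ h h′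
      (trans (imageDen-spec h≤k)
        (trans (sym (imageDen-spec h′≤k)) (cong (λ d → suc d + h′) (sym d≡d′)))))) refl

  -- Both sides are complements in k k′ Q: k d′ = k k′ Q - h′ k and k′ d = k k′ Q - h k′. Adding
  -- `h′ * k` to both sides avoids subtraction.
  complement-mono-≤ : ∀ h k d h′ k′ d′ → d + h ≡ k * Q → d′ + h′ ≡ k′ * Q →
                      h * k′ ≤ h′ * k → k * d′ ≤ k′ * d
  complement-mono-≤ h k d h′ k′ d′ eq eq′ le =
    +-cancelʳ-≤ (h′ * k) _ _ (begin
      k * d′ + h′ * k    ≡⟨ regroup k d′ h′ ⟩
      k * (d′ + h′)      ≡⟨ cong (k *_) eq′ ⟩
      k * (k′ * Q)       ≡⟨ swap k k′ Q ⟩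
      k′ * (k * Q)       ≡⟨ cong (k′ *_) eq ⟨
      k′ * (d + h)       ≡⟨ regroup k′ d h ⟨
      k′ * d + h * k′    ≤⟨ +-monoʳ-≤ (k′ * d) le ⟩
      k′ * d + h′ * k    ∎)
    where
    open ≤-Reasoning
    regroup : ∀ a b c → a * b + c * a ≡ a * (b + c)
    regroup = solve-∀
    swap : ∀ a b c → a * (b * c) ≡ b * (a * c)
    swap = solve-∀

  image-mono : ∀ {i x y} (f : IsFarey i x) (g : IsFarey i y) → x ℚ.≤ y → image f ℚ.≤ image g
  image-mono (fraction {h} {k-1} h≤k _) (fraction {h′} {k′-1} h′≤k′ _) (*≤* le) =
    *≤* (pos-*-mono-≤ k d′ k′ d
      (complement-mono-≤ h k d h′ k′ d′ (imageDen-spec h≤k) (imageDen-spec h′≤k′)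
        (pos-*-cancel-≤ h k′ h′ k le)))
    where
    k  = suc k-1
    k′ = suc k′-1
    d  = suc (imageDen-1 h k-1)
    d′ = suc (imageDen-1 h′ k′-1)

  -- Images and preimages in the target interval.

  codomain : ℕ → List ℚ
  codomain N = fareyBetween N (+ Q) (+ suc p)

  ∈-codomain⁺ : ∀ {N x} → IsFarey N x → + 1 / Q ℚ.≤ x → x ℚ.≤ + 1 / suc p → x ∈ codomain N
  ∈-codomain⁺ f lower upper =
    ∈-filter⁺ (λ x → (+ 1 / Q ℚ.≤? x) ×-dec (x ℚ.≤? + 1 / suc p)) (∈-farey⁺ f) (lower , upper)

  ∈-codomain⁻ : ∀ {N x} → x ∈ codomain N → IsFarey N x × + 1 / Q ℚ.≤ x × x ℚ.≤ + 1 / suc p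
  ∈-codomain⁻ {N} x∈ =
    let x∈F , bounds = ∈-filter⁻ (λ x → (+ 1 / Q ℚ.≤? x) ×-dec (x ℚ.≤? + 1 / suc p)) {xs = farey N} x∈
    in ∈-farey⁻ x∈F , bounds

  image-∈ : ∀ {N i x} → Q * i ≤ N → (f : IsFarey i x) → image f ∈ codomain N
  image-∈ {N} {i} Qi≤N (fraction {h} {k-1} h≤k k≤i) =
    -- The Farey condition k ≤ d comes from k ≤ k (q - 1) ≤ d, as q - 1 ≥ 1.
    ∈-codomain⁺ (fraction (≤-trans (m≤m*n k (suc p)) kQ-k≤d) d≤N)
                (1/n≤⁺ (suc p) d≤kQ) (≤1/n⁺ p kQ-k≤d)
    where
    k = suc k-1
    d = suc (imageDen-1 h k-1)
    d≤kQ : d ≤ k * Q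
    d≤kQ = ≤-trans (m≤m+n d h) (≤-reflexive (imageDen-spec h≤k))
    d≤N : d ≤ N
    d≤N = ≤-trans d≤kQ (≤-trans (*-monoˡ-≤ Q k≤i) (≤-trans (≤-reflexive (*-comm i Q)) Qi≤N))
    kQ-k≤d : k * suc p ≤ d
    kQ-k≤d = m≤m+n (k * suc p) (k ∸ h)

  -- If k > i, the chain N ≤ (i + 1)(q - 1) ≤ k (q - 1) ≤ d ≤ N collapses, so k divides d;
  -- coprimality then gives k = 1, against k > i ≥ 1.
  coprime⇒numerator≤i : ∀ {N i k d} .{{_ : ℕ.NonZero i}} → N ≤ suc i * suc p →
                        k * suc p ≤ d → d ≤ N → Coprime k d → k ≤ i
  coprime⇒numerator≤i {N} {i} {k} {d} N≤ kp≤d d≤N c = ≮⇒≥ λ i<k →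
    let d≡kp = ≤-antisym (≤-trans d≤N (≤-trans N≤ (*-monoˡ-≤ (suc p) i<k))) kp≤d
        k≡1  = c (∣-refl , subst (k ∣_) (sym d≡kp) (m∣m*n (suc p)))
    in contradiction (≤-trans (s≤s (ℕ.>-nonZero⁻¹ i)) (≤-trans i<k (≤-reflexive k≡1))) (<-irrefl refl)

  preimage : ∀ {N i y} .{{_ : ℕ.NonZero i}} → N ≤ suc i * suc p →
             IsFarey N y → + 1 / Q ℚ.≤ y → y ℚ.≤ + 1 / suc p →
             Σ[ x ∈ ℚ ] Σ[ f ∈ IsFarey i x ] image f ≡ y
  -- A zero numerator would violate the positive lower bound 1/q.
  preimage _ (fraction {zero} _ _) lower _ = contradiction (1/n≤⁻ (suc p) lower) λ ()
  preimage {N} {i} N≤ (fraction {suc k-1} {d-1} {c} _ d≤N) lower upper =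
    mkℚ (+ h) k-1 coprime , fraction h≤k k≤i ,
    ℚₚ.mkℚ-cong refl (suc-injective (+-cancelʳ-≡ h _ _ (trans (imageDen-spec h≤k) (sym d+h≡kQ))))
    where
    k = suc k-1
    d = suc d-1
    -- The truncated subtraction is exact: 1/q ≤ k/d says d ≤ k q. The upper bound k (q - 1) ≤ d
    -- becomes h ≤ k.
    h = k * Q ∸ d
    d+h≡kQ : d + h ≡ k * Q
    d+h≡kQ = m+[n∸m]≡n (1/n≤⁻ (suc p) lower)
    h≤k : h ≤ k
    h≤k = m≤n+o⇒m∸n≤o (k * Q) d (begin
      k * Q           ≡⟨ *-suc k (suc p) ⟩
      k + k * suc p   ≤⟨ +-monoʳ-≤ k (≤1/n⁻ p upper) ⟩
      k + d           ≡⟨ +-comm k d ⟩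
      d + k           ∎)
      where open ≤-Reasoning
    k≤i : k ≤ i
    k≤i = coprime⇒numerator≤i N≤ (≤1/n⁻ p upper) d≤N (Coprimality.recompute c)
    coprime : Coprime h k
    -- The relation d + h = k q is symmetric in `d` and `h`, so the same lemma carries coprimality
    -- back from `d` to `h`.
    coprime = Coprimality.sym (coprime-complement Q (trans (+-comm h d) d+h≡kQ) (Coprimality.sym (Coprimality.recompute c)))

  -- The order-preserving bijection.

  module _ {N i : ℕ} .{{_ : ℕ.NonZero i}} (Qi≤N : Q * i ≤ N) (N≤ : N ≤ suc i * suc p) where

    φ : Elem (farey i) → Elem (codomain N)
    φ (x , x∈) = image (∈-farey⁻ {i} x∈) , image-∈ Qi≤N (∈-farey⁻ {i} x∈)

    φ-isOrderHomomorphism : IsOrderHomomorphism _≈_ _≈_ _≲_ _≲_ φ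
    φ-isOrderHomomorphism = record
      { cong = λ { {_ , x∈} {_ , y∈} → image-cong (∈-farey⁻ {i} x∈) (∈-farey⁻ {i} y∈) }
      ; mono = λ { {_ , x∈} {_ , y∈} → image-mono (∈-farey⁻ {i} x∈) (∈-farey⁻ {i} y∈) }
      }

    φ-bijective : Bijective _≈_ _≈_ φ
    φ-bijective = injective , surjective
      where
      injective : ∀ {x y} → φ x ≈ φ y → x ≈ y
      injective {_ , x∈} {_ , y∈} = image-injective (∈-farey⁻ {i} x∈) (∈-farey⁻ {i} y∈)
      surjective : ∀ y → ∃ λ x → ∀ {z : Elem (farey i)} → z ≈ x → φ z ≈ y
      surjective (y , y∈) =
        let f , lower , upper = ∈-codomain⁻ {N} y∈
            x , g , eq        = preimage {N} {i} N≤ f lower upper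
        in (x , ∈-farey⁺ {i} g) , λ { {_ , z∈} z≡x → trans (image-cong (∈-farey⁻ {i} z∈) g z≡x) eq }

-- Consequences of the bounds on q.

-- If q ≤ 1, the strict bound gives N < i + 1, but i + 1 divides the positive number N.
q≥2 : ∀ N i q .{{_ : ℕ.NonZero N}} → suc i ∣ N → + N / suc i ℚ.< q / 1 → + 2 ℤ.≤ q
q≥2 N i q i+1∣N N/i+1<q = ℤₚ.i<j⇒suc[i]≤j {+ 1} (ℤₚ.≰⇒> λ q≤1 →
  ℤₚ.<⇒≱ (/-cancel-< (+ N) q i 0 N/i+1<q) (begin
    q ℤ.* + suc i     ≤⟨ ℤₚ.*-monoʳ-≤-nonNeg (+ suc i) q≤1 ⟩
    + 1 ℤ.* + suc i   ≡⟨ ℤₚ.*-identityˡ (+ suc i) ⟩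
    + suc i           ≤⟨ +≤+ (∣⇒≤ i+1∣N) ⟩
    + N               ≡⟨ ℤₚ.*-identityʳ (+ N) ⟨
    + N ℤ.* + 1       ∎))
  where open ℤₚ.≤-Reasoning

-- Writing N = c (i + 1), the bound N/(i + 1) < q says c < q, and integrality improves this to c ≤ q
-- - 1.
N≤[i+1][q-1] : ∀ N i p → suc i ∣ N → + N / suc i ℚ.< + suc (suc p) / 1 → N ≤ suc i * suc p
N≤[i+1][q-1] _ i p (divides c refl) N/i+1<q =
  ≤-trans (*-monoˡ-≤ (suc i) (ℕ.s≤s⁻¹ c<q)) (≤-reflexive (*-comm (suc p) (suc i)))
  where
  c<q : c < suc (suc p)
  c<q = *-cancelʳ-< (suc i) c (suc (suc p)) (ℤₚ.drop‿+<+
    (subst₂ ℤ._<_ (ℤₚ.*-identityʳ (+ (c * suc i))) (sym (ℤₚ.pos-* (suc (suc p)) (suc i)))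
      (/-cancel-< (+ (c * suc i)) (+ suc (suc p)) i 0 N/i+1<q)))

qi≤N : ∀ N i q → + q / 1 ℚ.≤ + N / suc i → q * suc i ≤ N
qi≤N N i q q≤N/i =
  ≤-trans (pos-*-cancel-≤ q (suc i) N 1 (/-cancel-≤ (+ q) (+ N) 0 i q≤N/i))
          (≤-reflexive (*-identityʳ N))

theorem2 :
    (N i : ℕ) .{{_ : ℕ.NonZero N}} .{{_ : ℕ.NonZero i}} →
    i ∣ N → suc i ∣ N →
    (q : ℤ) → + N / suc i ℚ.< q / 1 → q / 1 ℚ.≤ + N / i →
    Σ[ 2≤q ∈ + 2 ℤ.≤ q ]
      let domain   = farey i
          codomain = fareyBetween N q (q ℤ.- + 1) {{nonZero-q 2≤q}} {{nonZero-q-1 2≤q}}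
      in
      Σ[ φ ∈ (Elem domain → Elem codomain) ]
        ((x : Elem domain) →
          let h = ↥ (proj₁ x)
              k = ↧ (proj₁ x)
          in
          Σ[ kq-h≢0 ∈ ℤ.NonZero (k ℤ.* q ℤ.- h) ]
            proj₁ (φ x) ≡ (k ÷ (k ℤ.* q ℤ.- h)) {{kq-h≢0}})
        × IsOrderHomomorphism _≈_ _≈_ _≲_ _≲_ φ
        × Bijective _≈_ _≈_ φ
theorem2 N (suc i-1) _ i+1∣N (+ suc (suc p)) N/i+1<q q≤N/i =
  -- For this form of q, `q ℤ.- + 1` computes to `+ suc p`, so the target list is definitionally
  -- `codomain p N`.
  +≤+ (s≤s (s≤s z≤n)) , φ p qi≤N′ N≤ , (λ (x , x∈) → image-formula p (∈-farey⁻ {suc i-1} x∈)) ,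
  φ-isOrderHomomorphism p qi≤N′ N≤ , φ-bijective p qi≤N′ N≤
  where
  qi≤N′ = qi≤N N i-1 (suc (suc p)) q≤N/i
  N≤    = N≤[i+1][q-1] N (suc i-1) p i+1∣N N/i+1<q
theorem2 N i _ i+1∣N (+ 0) N/i+1<q _ = contradiction (q≥2 N i (+ 0) i+1∣N N/i+1<q) λ { (+≤+ ()) }
theorem2 N i _ i+1∣N (+ 1) N/i+1<q _ = contradiction (q≥2 N i (+ 1) i+1∣N N/i+1<q) λ { (+≤+ (s≤s ())) }
theorem2 N i _ i+1∣N -[1+ n ] N/i+1<q _ = contradiction (q≥2 N i -[1+ n ] i+1∣N N/i+1<q) λ ()
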